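{- Let $G=(V,E)$ be a finite simple graph of order $n$. If $Z(D_t(G,x))=\{ -1,0\}$, then $G$ has at least two support vertices.
   Context: A leaf is a vertex of degree one; a support vertex is a vertex adjacent to a leaf. For a finite simple graph $G=(V,E)$, a set $D\subseteq V$ is a total dominating set if every vertex of $V$ is adjacent to some vertex of $D$. $d_t(G,i)$ is the number of total dominating sets of $G$ of cardinality $i$, and $D_t(G,x)=\sum_i d_t(G,i)x^i$ is the total domination polynomial. $Z(D_t(G,x))$ denotes the set of distinct (complex) roots of $D_t(G,x)$. -}

module Defs where

open import Level using (_⊔_) renaming (suc to lsuc)
open import Algebra.Apartness.Bundles using (HeytingField; HeytingCommutativeRing)
open import Algebra.Bundles using (CommutativeRing; Semiring)
import Algebra.Definitions.RawSemiring as SemiringOps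
open import Data.Fin.Base using (Fin; toℕ; fromℕ)
open import Data.Fin.Properties using (all?; any?)
open import Data.Fin.Subset using (Subset; inside; outside; _∈_; ∣_∣)
open import Data.Fin.Subset.Properties using (_∈?_)
open import Data.List.Base using (List; []; _∷_; _++_; map; filter; length)
open import Data.Nat.Base using (ℕ; zero; suc)
import Data.Nat.Properties as ℕ
open import Data.Product.Base using (∃-syntax; _×_)
open import Data.Vec.Base as Vec using (tabulate)
open import Data.Vec.Functional using (Vector)
open import Relation.Binary.Core using (Rel)
open import Relation.Binary.Definitions using (Decidable; Symmetric; Irreflexive)
open import Relation.Binary.PropositionalEquality.Core using (_≡_; _≢_)
open import Relation.Nullary.Decidable using (Dec; does; _×-dec_)
open import Relation.Nullary.Negation using (¬_)
open import Relation.Unary using (Pred)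

private
  variable
    n : ℕ

record SimpleGraph (n : ℕ) : Set₁ where
  infix 4 _~_ _~?_
  field
    _~_    : Rel (Fin n) _
    _~?_   : Decidable _~_
    sym    : Symmetric _~_
    irrefl : Irreflexive _≡_ _~_

module _ (G : SimpleGraph n) where
  open SimpleGraph G

  degree : Fin n → ℕ
  degree v = ∣ tabulate (λ u → does (v ~? u)) ∣

  Leaf : Pred (Fin n) _
  Leaf v = degree v ≡ 1

  SupportVertex : Pred (Fin n) _
  SupportVertex v = ∃[ u ] (Leaf u × v ~ u)

  AtLeastTwoSupportVertices : Set
  AtLeastTwoSupportVertices =
    ∃[ u ] ∃[ v ] (u ≢ v × SupportVertex u × SupportVertex v)

  TotalDominating : Pred (Subset n) _
  TotalDominating D = ∀ v → ∃[ u ] (u ∈ D × v ~ u)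

  totalDominating? : ∀ D → Dec (TotalDominating D)
  totalDominating? D = all? (λ v → any? (λ u → (u ∈? D) ×-dec (v ~? u)))

-- Lists every subset of Fin n exactly once.
allSubsets : ∀ n → List (Subset n)
allSubsets zero    = Vec.[] ∷ []
allSubsets (suc n) =
  map (outside Vec.∷_) (allSubsets n) ++ map (inside Vec.∷_) (allSubsets n)

dₜ : SimpleGraph n → ℕ → ℕ
dₜ {n} G i = length
  (filter (λ D → totalDominating? G D ×-dec (∣ D ∣ ℕ.≟ i)) (allSubsets n))

-- A polynomial is its vector of coefficients, constant term first.  No subset
-- of the vertices has more than n elements, so degrees 0, …, n suffice.
Dₜ : SimpleGraph n → Vector ℕ (suc n)
Dₜ G i = dₜ G (toℕ i)

module Polynomial {c ℓ₁ ℓ₂} (F : HeytingField c ℓ₁ ℓ₂) where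
  open HeytingField F using (Carrier; _≈_; _*_; 0#; 1#; heytingCommutativeRing)
  open HeytingCommutativeRing heytingCommutativeRing using (commutativeRing)
  open SemiringOps (Semiring.rawSemiring (CommutativeRing.semiring commutativeRing)) public
    using (sum; _^_) renaming (_×_ to _·_)

  eval : ∀ {m} → Vector Carrier m → Carrier → Carrier
  eval p x = sum (λ i → p i * x ^ toℕ i)

  -- Natural-number coefficients are read in F through k ↦ 1 + ⋯ + 1.
  fromℕ-coeffs : ∀ {m} → Vector ℕ m → Vector Carrier m
  fromℕ-coeffs p i = p i · 1#

  Z : ∀ {m} → Vector ℕ m → Pred Carrier ℓ₁
  Z p x = eval (fromℕ-coeffs p) x ≈ 0#

-- The library has no complex numbers.  They enter through the structure that
-- matters for roots of polynomials: a field of characteristic zero in which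
-- every polynomial of positive degree has a root.  Inequality is expressed by
-- a tight apartness relation, as in Bishop's constructive ℂ, so that equality
-- of numbers need not be decidable; classically # is just ≉.
record AlgebraicallyClosedField₀ c ℓ₁ ℓ₂ : Set (lsuc (c ⊔ ℓ₁ ⊔ ℓ₂)) where
  field
    heytingField : HeytingField c ℓ₁ ℓ₂

  open HeytingField heytingField public
  open Polynomial heytingField public

  field
    characteristicZero  : ∀ k → ¬ (suc k · 1# ≈ 0#)
    -- p has degree exactly d + 1, its leading coefficient being apart from 0.
    algebraicallyClosed : ∀ d (p : Vector Carrier (suc (suc d))) →
                          p (fromℕ (suc d)) # 0# → ∃[ x ] (eval p x ≈ 0#)

{-# OPTIONS --safe #-}

-- Were there an isolated vertex, Dₜ would be 0 and every number a root.  Otherwise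
-- the set V ∖ {v} is totally dominating unless v is a support vertex, so dₜ(G, n−1)
-- is at least n minus the number of support vertices.  On the other side, Dₜ is
-- monic of degree n and divisible by x², since no set of fewer than two vertices is
-- totally dominating.  If all roots are 0 or −1, then dₜ(G, n−1), the subleading
-- coefficient of Dₜ / x², is minus the sum of n − 2 roots, hence a natural number at
-- most n − 2, and there are at least two support vertices.

module Submission where

open import Defs
open import Algebra.Apartness.Bundles using (HeytingField; HeytingCommutativeRing)
import Algebra.Apartness.Properties.HeytingCommutativeRing as HeytingProperties
open import Algebra.Bundles using (CommutativeRing)
import Algebra.Properties.Group as GroupProperties
import Algebra.Properties.Semiring.Sum as SemiringSum
import Algebra.Solver.Ring.NaturalCoefficients.Default as SemiringSolver
open import Data.Bool.Base using (true; false)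
open import Data.Empty using (⊥-elim)
open import Data.Fin.Base using (Fin; zero; suc; toℕ; fromℕ; inject₁)
open import Data.Fin.Properties using (any?; toℕ-fromℕ; toℕ-inject₁; suc-injective)
  renaming (_≟_ to _≟ᶠ_)
open import Data.Fin.Subset using (Subset; inside; outside; _∈_; ∣_∣; ⊤; ⊥; ⁅_⁆; ∁)
open import Data.Fin.Subset.Properties
open import Data.List.Base using ([]; _∷_; map; filter; length)
open import Data.List.Properties using (length-++; filter-++)
open import Data.Nat.Base using (ℕ; zero; suc; _≤_; _<_; z≤n; s≤s; _∸_)
import Data.Nat.Base as ℕ
import Data.Nat.Properties as ℕ
open import Data.Product.Base using (∃-syntax; _×_; _,_; proj₁; proj₂)
open import Data.Sum.Base using (_⊎_; inj₁; inj₂; fromInj₁)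
open import Data.Vec.Base as Vec using (tabulate)
open import Data.Vec.Functional using (Vector; tail)
open import Data.Vec.Properties using ([]=⇒lookup; lookup⇒[]=; lookup∘tabulate)
open import Function.Base using (_∘_)
open import Level using (0ℓ; _⊔_)
open import Relation.Binary.PropositionalEquality.Core
  using (_≡_; _≢_; refl; sym; trans; cong; cong₂; subst)
open import Relation.Nullary.Decidable using (yes; no; does; dec-true; decidable-stable; _×-dec_; ¬?)
open import Relation.Nullary.Negation using (¬_; contradiction)
open import Relation.Unary using (Pred; Decidable; _≐_; _∪_)

private
  variable
    n : ℕ

-- Counting the subsets with a decidable property.

filter-map-length : ∀ {A B : Set} {P : Pred B 0ℓ} (P? : Decidable P) (f : A → B) xs →
  length (filter P? (map f xs)) ≡ length (filter (P? ∘ f) xs)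
filter-map-length P? f []       = refl
filter-map-length P? f (x ∷ xs) with does (P? (f x))
... | true  = cong suc (filter-map-length P? f xs)
... | false = filter-map-length P? f xs

countSubsets : {P : Pred (Subset n) 0ℓ} → Decidable P → ℕ
countSubsets {n} P? = length (filter P? (allSubsets n))

countSubsets-suc : {P : Pred (Subset (suc n)) 0ℓ} (P? : Decidable P) →
  countSubsets P? ≡
    countSubsets (P? ∘ (outside Vec.∷_)) ℕ.+ countSubsets (P? ∘ (inside Vec.∷_))
countSubsets-suc {n} P? = trans
  (cong length (filter-++ P? (map (outside Vec.∷_) (allSubsets n)) _))
  (trans (length-++ (filter P? (map (outside Vec.∷_) (allSubsets n))))
    (cong₂ ℕ._+_ (filter-map-length P? _ (allSubsets n))
                 (filter-map-length P? _ (allSubsets n))))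

countSubsets≡0 : {P : Pred (Subset n) 0ℓ} (P? : Decidable P) →
  (∀ D → ¬ P D) → countSubsets P? ≡ 0
countSubsets≡0 {zero} P? ¬P with P? Vec.[]
... | yes p = contradiction p (¬P _)
... | no  _ = refl
countSubsets≡0 {suc n} P? ¬P = trans (countSubsets-suc P?)
  (cong₂ ℕ._+_ (countSubsets≡0 (P? ∘ (outside Vec.∷_)) (λ _ → ¬P _))
               (countSubsets≡0 (P? ∘ (inside Vec.∷_)) (λ _ → ¬P _)))

countSubsets-⊤ : {P : Pred (Subset n) 0ℓ} (P? : Decidable P) → P ⊤ → 1 ≤ countSubsets P?
countSubsets-⊤ {zero} P? P⊤ with P? Vec.[]
... | yes _ = ℕ.≤-refl
... | no ¬p = contradiction P⊤ ¬p
countSubsets-⊤ {suc n} P? P⊤ = subst (1 ≤_) (sym (countSubsets-suc P?))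
  (ℕ.≤-trans (countSubsets-⊤ (P? ∘ (inside Vec.∷_)) P⊤) (ℕ.m≤n+m _ _))

countSubsets≡1 : {P : Pred (Subset n) 0ℓ} (P? : Decidable P) →
  P ⊤ → (∀ D → P D → D ≡ ⊤) → countSubsets P? ≡ 1
countSubsets≡1 {zero} P? P⊤ _ with P? Vec.[]
... | yes _ = refl
... | no ¬p = contradiction P⊤ ¬p
countSubsets≡1 {suc n} P? P⊤ only = trans (countSubsets-suc P?)
  (cong₂ ℕ._+_
    (countSubsets≡0 (P? ∘ (outside Vec.∷_)) (λ D p → outside≢inside (only _ p)))
    (countSubsets≡1 (P? ∘ (inside Vec.∷_)) P⊤ (λ D p → cong Vec.tail (only _ p))))
  where
  outside≢inside : ∀ {D : Subset n} → outside Vec.∷ D ≢ inside Vec.∷ ⊤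
  outside≢inside ()

-- Counting complements of single points.

∁⊥≡⊤ : ∁ (⊥ {n}) ≡ ⊤
∁⊥≡⊤ {zero}  = refl
∁⊥≡⊤ {suc n} = cong (inside Vec.∷_) ∁⊥≡⊤

module _ {P : Pred (Subset (suc n)) 0ℓ} (P? : Decidable P) where

  countSubsets-inside : ∀ {k} → k ≤ countSubsets (P? ∘ (inside Vec.∷_)) → k ≤ countSubsets P?
  countSubsets-inside k≤ =
    subst (_ ≤_) (sym (countSubsets-suc P?)) (ℕ.≤-trans k≤ (ℕ.m≤n+m _ _))

  -- `∁ ⁅ zero ⁆` omits the first point, so it adds one to what is counted among the sets that
  -- contain it.
  countSubsets-both : ∀ {k} → P (∁ ⁅ zero ⁆) →
    k ≤ countSubsets (P? ∘ (inside Vec.∷_)) → suc k ≤ countSubsets P?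
  countSubsets-both p k≤ = subst (_ ≤_) (sym (countSubsets-suc P?))
    (ℕ.+-mono-≤ (countSubsets-⊤ (P? ∘ (outside Vec.∷_))
                  (subst (P ∘ (outside Vec.∷_)) ∁⊥≡⊤ p)) k≤)

-- The points v with ¬ S v contribute the distinct sets ∁ ⁅ v ⁆ to the count.
atLeastOne : {P : Pred (Subset n) 0ℓ} (P? : Decidable P)
  {S : Pred (Fin n) 0ℓ} (S? : Decidable S) →
  (∀ v → ¬ S v → P (∁ ⁅ v ⁆)) → (∃[ v ] S v) ⊎ n ≤ countSubsets P?
atLeastOne {zero}  P? S? co = inj₂ z≤n
atLeastOne {suc n} P? S? co with S? zero
... | yes s = inj₁ (zero , s)
... | no ¬s with atLeastOne (P? ∘ (inside Vec.∷_)) (S? ∘ suc) (co ∘ suc)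
...   | inj₁ (v , s) = inj₁ (suc v , s)
...   | inj₂ n≤      = inj₂ (countSubsets-both P? (co zero ¬s) n≤)

-- Scan the points in order: each one outside `S` adds a set to the count, and after the first one
-- in `S` the search for a second is left to `atLeastOne`. `co ∘ suc` fits because `∁ ⁅ suc v ⁆`
-- reduces to `inside ∷ ∁ ⁅ v ⁆`.
atLeastTwo : {P : Pred (Subset n) 0ℓ} (P? : Decidable P)
  {S : Pred (Fin n) 0ℓ} (S? : Decidable S) →
  (∀ v → ¬ S v → P (∁ ⁅ v ⁆)) →
  (∃[ u ] ∃[ v ] (u ≢ v × S u × S v)) ⊎ n ≤ suc (countSubsets P?)
atLeastTwo {zero}  P? S? co = inj₂ z≤n
atLeastTwo {suc n} P? S? co with S? zero
atLeastTwo {suc n} P? S? co | yes s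
  with atLeastOne (P? ∘ (inside Vec.∷_)) (S? ∘ suc) (co ∘ suc)
... | inj₁ (v , s′) = inj₁ (zero , suc v , (λ ()) , s , s′)
... | inj₂ n≤       = inj₂ (s≤s (countSubsets-inside P? n≤))
atLeastTwo {suc n} P? S? co | no ¬s
  with atLeastTwo (P? ∘ (inside Vec.∷_)) (S? ∘ suc) (co ∘ suc)
... | inj₁ (u , v , u≢v , su , sv) =
        inj₁ (suc u , suc v , u≢v ∘ suc-injective , su , sv)
... | inj₂ n≤ with countSubsets-both P? (co zero ¬s) ℕ.≤-refl
...   | 1+k≤ = inj₂ (s≤s (ℕ.≤-trans n≤ 1+k≤))

-- Total dominating sets of extreme sizes.

module _ (G : SimpleGraph n) where
  open SimpleGraph G renaming (sym to ~-sym)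

  OfSize : ℕ → Pred (Subset n) 0ℓ
  OfSize i D = TotalDominating G D × ∣ D ∣ ≡ i

  ofSize? : ∀ i → Decidable (OfSize i)
  ofSize? i D = totalDominating? G D ×-dec (∣ D ∣ ℕ.≟ i)

  TotalDominating-mono : ∀ {D E} → (∀ {u} → u ∈ D → u ∈ E) →
    TotalDominating G D → TotalDominating G E
  TotalDominating-mono D⊆E td v with td v
  ... | u , u∈D , v~u = u , D⊆E u∈D , v~u

  -- A member `u` of `D` itself needs a neighbour in `D`, which differs from `u` as there are no
  -- loops; so `⁅ u ⁆` is a proper subset of `D`.
  TotalDominating⇒1<∣D∣ : ∀ {D} → Fin n → TotalDominating G D → 1 < ∣ D ∣
  TotalDominating⇒1<∣D∣ {D} v td with td v
  ... | u , u∈D , _ with td u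
  ...   | w , w∈D , u~w = subst (_< ∣ D ∣) (∣⁅x⁆∣≡1 u) (p⊂q⇒∣p∣<∣q∣
          ( (λ x∈ → subst (_∈ D) (sym (x∈⁅y⁆⇒x≡y u x∈)) u∈D)
          , w , w∈D , λ w∈ → irrefl (sym (x∈⁅y⁆⇒x≡y u w∈)) u~w))

  -- The given vertex rules out the empty graph, where the empty set is totally dominating.
  dₜ-small : ∀ {i} → Fin n → i ≤ 1 → dₜ G i ≡ 0
  dₜ-small {i} v i≤1 = countSubsets≡0 (ofSize? i) λ D (td , ∣D∣≡i) →
    ℕ.<⇒≱ (TotalDominating⇒1<∣D∣ v td) (subst (_≤ 1) (sym ∣D∣≡i) i≤1)

  dₜ-top : TotalDominating G ⊤ → dₜ G n ≡ 1
  dₜ-top td = countSubsets≡1 (ofSize? n) (td , ∣⊤∣≡n n) (λ D p → ∣p∣≡n⇒p≡⊤ (proj₂ p))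

  -- The hypothesis says that some vertex is isolated; supersets of total dominating sets are again
  -- totally dominating, so there are none at all.
  dₜ-isolated : ¬ TotalDominating G ⊤ → ∀ i → dₜ G i ≡ 0
  dₜ-isolated ¬td i = countSubsets≡0 (ofSize? i) λ D p →
    ¬td (TotalDominating-mono (λ _ → ∈⊤) (proj₁ p))

  supportVertex? : Decidable (SupportVertex G)
  supportVertex? v = any? (λ u → (degree G u ℕ.≟ 1) ×-dec (v ~? u))

  leaf : ∀ {w v} → w ~ v → (∀ u → w ~ u → u ≡ v) → Leaf G w
  leaf {w} {v} w~v unique = trans (cong ∣_∣ nbhd≡⁅v⁆) (∣⁅x⁆∣≡1 v)
    where
    nbhd : Subset n
    nbhd = tabulate (λ u → does (w ~? u))

    ∈nbhd⇒~ : ∀ {u} → u ∈ nbhd → w ~ u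
    -- The membership equation is abstracted along with the decision, so a negative answer turns it
    -- into `false ≡ true`.
    ∈nbhd⇒~ {u} u∈ with w ~? u
      | trans (sym (lookup∘tabulate (λ u → does (w ~? u)) u)) ([]=⇒lookup u∈)
    ... | yes w~u | _ = w~u
    ... | no _ | ()

    nbhd≡⁅v⁆ : nbhd ≡ ⁅ v ⁆
    nbhd≡⁅v⁆ = ⊆-antisym
      (λ {u} u∈ → subst (_∈ ⁅ v ⁆) (sym (unique u (∈nbhd⇒~ u∈))) (x∈⁅x⁆ v))
      (λ {u} u∈ → subst (_∈ nbhd) (sym (x∈⁅y⁆⇒x≡y v u∈))
        (lookup⇒[]= v nbhd (trans (lookup∘tabulate _ v) (dec-true (w ~? v) w~v))))

  -- A vertex `w` that `∁ ⁅ v ⁆` fails to dominate has `v` as its only neighbour, so it is a leaf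
  -- and `v` supports it.
  ∁⁅v⁆-TotalDominating : TotalDominating G ⊤ → ∀ v → ¬ SupportVertex G v →
    TotalDominating G (∁ ⁅ v ⁆)
  ∁⁅v⁆-TotalDominating td v ¬sv w with any? (λ u → ¬? (u ≟ᶠ v) ×-dec (w ~? u))
  ... | yes (u , u≢v , w~u) = u , x∉p⇒x∈∁p (u≢v ∘ x∈⁅y⁆⇒x≡y v) , w~u
  ... | no none = ⊥-elim (¬sv (w , leaf w~v unique , ~-sym w~v))
    where
    unique : ∀ u → w ~ u → u ≡ v
    unique u w~u with u ≟ᶠ v
    ... | yes u≡v = u≡v
    ... | no  u≢v = contradiction (u , u≢v , w~u) none

    w~v : w ~ v
    w~v with td w
    ... | u , _ , w~u = subst (w ~_) (unique u w~u) w~u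

  twoSupportVertices⊎n≤1+dₜ : TotalDominating G ⊤ →
    AtLeastTwoSupportVertices G ⊎ n ≤ suc (dₜ G (n ∸ 1))
  twoSupportVertices⊎n≤1+dₜ td = atLeastTwo (ofSize? (n ∸ 1)) supportVertex? λ v ¬sv →
    ∁⁅v⁆-TotalDominating td v ¬sv ,
    trans (∣∁p∣≡n∸∣p∣ ⁅ v ⁆) (cong (n ∸_) (∣⁅x⁆∣≡1 v))

-- Polynomials over a Heyting field and division by a linear factor.

lead : ∀ {a} {A : Set a} {m} → Vector A (suc m) → A
lead {m = m} p = p (fromℕ m)

module HeytingPolynomial {c ℓ₁ ℓ₂} (F : HeytingField c ℓ₁ ℓ₂) where
  open HeytingField F using (heytingCommutativeRing)
  open HeytingCommutativeRing heytingCommutativeRing using (commutativeRing)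
  open CommutativeRing commutativeRing hiding (zero)
    renaming (refl to ≈-refl; sym to ≈-sym; trans to ≈-trans)
  open Polynomial F
  open SemiringSum semiring using (*-distribˡ-sum; sum-cong-≋)
  open SemiringSolver commutativeSemiring using (solve; _:+_; _:*_; _:=_)
  open import Relation.Binary.Reasoning.Setoid setoid

  eval-tail : ∀ {m} (p : Vector Carrier (suc m)) x →
    eval p x ≈ p zero + x * eval (tail p) x
  eval-tail p x = +-cong (*-identityʳ _) (begin
    sum (λ i → p (suc i) * (x * x ^ toℕ i))
      ≈⟨ sum-cong-≋ (λ i → solve 3 (λ a x y → a :* (x :* y) := x :* (a :* y))
                             ≈-refl (p (suc i)) x (x ^ toℕ i)) ⟩
    sum (λ i → x * (p (suc i) * x ^ toℕ i))
      ≈⟨ *-distribˡ-sum x (λ i → p (suc i) * x ^ toℕ i) ⟨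
    x * eval (tail p) x ∎)

  eval-constant : (p : Vector Carrier 1) → ∀ x → eval p x ≈ p zero
  eval-constant p x = ≈-trans (+-identityʳ _) (*-identityʳ _)

  eval-tail-root : ∀ {m} (p : Vector Carrier (suc m)) {x} →
    p zero ≈ 0# → eval (tail p) x ≈ 0# → eval p x ≈ 0#
  eval-tail-root p {x} p₀≈0 root = begin
    eval p x                   ≈⟨ eval-tail p x ⟩
    p zero + x * eval (tail p) x ≈⟨ +-cong p₀≈0 (*-congˡ root) ⟩
    0# + x * 0#                ≈⟨ +-identityˡ _ ⟩
    x * 0#                     ≈⟨ zeroʳ x ⟩
    0#                         ∎

  eval-zero : ∀ {m} (p : Vector Carrier m) → (∀ i → p i ≈ 0#) → ∀ x → eval p x ≈ 0#
  eval-zero {zero}  p p≈0 x = ≈-refl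
  eval-zero {suc m} p p≈0 x = eval-tail-root p (p≈0 zero) (eval-zero (tail p) (p≈0 ∘ suc) x)

  -- The quotient of p by x − r (Horner's scheme).
  quotient : ∀ {m} → Vector Carrier (suc m) → Carrier → Vector Carrier m
  quotient p r zero    = eval (tail p) r
  quotient p r (suc i) = quotient (tail p) r i

  -- p(x) = (x − r) q(x) + p(r), with both sides moved so that no subtraction occurs.
  eval-quotient : ∀ {m} (p : Vector Carrier (suc m)) r x →
    eval p x + r * eval (quotient p r) x ≈ x * eval (quotient p r) x + eval p r
  eval-quotient {zero} p r x = begin
    eval p x + r * 0#  ≈⟨ +-cong (eval-constant p x) (zeroʳ r) ⟩
    p zero + 0#        ≈⟨ +-comm _ _ ⟩
    0# + p zero        ≈⟨ +-cong (zeroʳ x) (eval-constant p r) ⟨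
    x * 0# + eval p r  ∎
  eval-quotient {suc m} p r x = begin
    eval p x + r * eval q x
      ≈⟨ +-cong (eval-tail p x) (*-congˡ (eval-tail q x)) ⟩
    (a + x * P′x) + r * (P′r + x * Q′)
      ≈⟨ solve 6 (λ a x r P′x P′r Q′ → (a :+ x :* P′x) :+ r :* (P′r :+ x :* Q′)
                    := (a :+ r :* P′r) :+ x :* (P′x :+ r :* Q′))
               ≈-refl a x r P′x P′r Q′ ⟩
    (a + r * P′r) + x * (P′x + r * Q′)
      ≈⟨ +-congˡ (*-congˡ (eval-quotient (tail p) r x)) ⟩
    (a + r * P′r) + x * (x * Q′ + P′r)
      ≈⟨ solve 5 (λ a x r P′r Q′ → (a :+ r :* P′r) :+ x :* (x :* Q′ :+ P′r)
                    := x :* (P′r :+ x :* Q′) :+ (a :+ r :* P′r))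
               ≈-refl a x r P′r Q′ ⟩
    x * (P′r + x * Q′) + (a + r * P′r)
      ≈⟨ +-cong (*-congˡ (eval-tail q x)) (eval-tail p r) ⟨
    x * eval q x + eval p r ∎
    where
    q   = quotient p r
    a   = p zero
    P′x = eval (tail p) x
    P′r = eval (tail p) r
    Q′  = eval (quotient (tail p) r) x

  -- Through this, a restriction on the roots of `p` passes to the quotient.
  quotient-root : ∀ {m} (p : Vector Carrier (suc m)) {r x} →
    eval p r ≈ 0# → eval (quotient p r) x ≈ 0# → eval p x ≈ 0#
  quotient-root p {r} {x} pr≈0 qx≈0 = begin
    eval p x                                   ≈⟨ +-identityʳ _ ⟨
    eval p x + 0#                              ≈⟨ +-congˡ (vanish r) ⟨
    eval p x + r * eval (quotient p r) x       ≈⟨ eval-quotient p r x ⟩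
    x * eval (quotient p r) x + eval p r       ≈⟨ +-cong (vanish x) pr≈0 ⟩
    0# + 0#                                    ≈⟨ +-identityˡ 0# ⟩
    0#                                         ∎
    where
    vanish : ∀ y → y * eval (quotient p r) x ≈ 0#
    vanish y = ≈-trans (*-congˡ qx≈0) (zeroʳ y)

  lead-quotient : ∀ {m} (p : Vector Carrier (suc (suc m))) r →
    lead (quotient p r) ≈ lead p
  lead-quotient {zero}  p r = eval-constant (tail p) r
  lead-quotient {suc m} p r = lead-quotient (tail p) r

  -- The coefficient of degree m − 1; a constant polynomial gets 0.
  sublead : ∀ {m} → Vector Carrier (suc m) → Carrier
  sublead {zero}  p = 0#
  sublead {suc m} p = p (inject₁ (fromℕ m))

  -- One step of Vieta's formula: compare the coefficients just below the top in `p = (x − r) q`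
  -- with `p` monic.
  sublead-quotient : ∀ {m} (p : Vector Carrier (suc (suc m))) {r} →
    lead p ≈ 1# → eval p r ≈ 0# → sublead (quotient p r) ≈ sublead p + r
  -- For linear `p` the quotient is constant with `sublead` 0 by convention, and the identity is
  -- `eval p r ≈ 0#` itself.
  sublead-quotient {zero} p {r} lead≈1 root = begin
    0#                             ≈⟨ root ⟨
    eval p r                       ≈⟨ eval-tail p r ⟩
    p zero + r * eval (tail p) r   ≈⟨ +-congˡ (*-congˡ (eval-constant (tail p) r)) ⟩
    p zero + r * p (suc zero)      ≈⟨ +-congˡ (*-congˡ lead≈1) ⟩
    p zero + r * 1#                ≈⟨ +-congˡ (*-identityʳ r) ⟩
    p zero + r                     ∎
  sublead-quotient {suc m} p {r} lead≈1 _ = go p lead≈1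
    where
    -- Dropping the constant term keeps the top two coefficients of both `p` and its quotient, but
    -- not the root at `r`; hence the induction carries only monicity.
    go : ∀ {m} (p : Vector Carrier (suc (suc (suc m)))) → lead p ≈ 1# →
      sublead (quotient p r) ≈ sublead p + r
    go {zero} p lead≈1 = begin
      eval (tail p) r                            ≈⟨ eval-tail (tail p) r ⟩
      p (suc zero) + r * eval (tail (tail p)) r
        ≈⟨ +-congˡ (*-congˡ (eval-constant (tail (tail p)) r)) ⟩
      p (suc zero) + r * lead p                  ≈⟨ +-congˡ (*-congˡ lead≈1) ⟩
      p (suc zero) + r * 1#                      ≈⟨ +-congˡ (*-identityʳ r) ⟩
      p (suc zero) + r                           ∎
    go {suc m} p lead≈1 = go (tail p) lead≈1

-- Bounding the subleading coefficient by the roots, and the conclusion.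

module ClosedField {c ℓ₁ ℓ₂} (K : AlgebraicallyClosedField₀ c ℓ₁ ℓ₂) where
  open AlgebraicallyClosedField₀ K
    using (heytingField; heytingCommutativeRing; characteristicZero; algebraicallyClosed)
  open HeytingCommutativeRing heytingCommutativeRing using (commutativeRing)
  open CommutativeRing commutativeRing hiding (zero)
    renaming (refl to ≈-refl; sym to ≈-sym; trans to ≈-trans)
  open Polynomial heytingField
  open HeytingPolynomial heytingField
  open HeytingProperties heytingCommutativeRing using (#-congʳ; 1#0)
  open GroupProperties +-group using (∙-cancelˡ)
  open import Relation.Binary.Reasoning.Setoid setoid

  ·-injective : ∀ j k → j · 1# ≈ k · 1# → j ≡ k
  ·-injective zero    zero    _  = refl
  ·-injective zero    (suc k) eq = contradiction (≈-sym eq) (characteristicZero k)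
  ·-injective (suc j) zero    eq = contradiction eq (characteristicZero j)
  ·-injective (suc j) (suc k) eq = cong suc (·-injective j k (∙-cancelˡ 1# _ _ eq))

  -- For a monic polynomial with all roots 0 or -1, `k` is the multiplicity of the root -1.
  SubleadBounded : ∀ {m} → Vector Carrier (suc m) → Set ℓ₁
  SubleadBounded {m} p = ∃[ k ] (k ≤ m × sublead p ≈ k · 1#)

  -- Since `sublead p` is `sublead (quotient p r)` minus `r`, a root 0 keeps `k` and a root -1
  -- raises it by one.
  sublead-bounded-step : ∀ {m} (p : Vector Carrier (suc (suc m))) {r} →
    sublead (quotient p r) ≈ sublead p + r → r ≈ - 1# ⊎ r ≈ 0# →
    SubleadBounded (quotient p r) → SubleadBounded p
  sublead-bounded-step p {r} eq (inj₂ r≈0) (k , k≤m , sublead≈k) =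
    k , ℕ.m≤n⇒m≤1+n k≤m , (begin
      sublead p                 ≈⟨ +-identityʳ _ ⟨
      sublead p + 0#            ≈⟨ +-congˡ r≈0 ⟨
      sublead p + r             ≈⟨ eq ⟨
      sublead (quotient p r)    ≈⟨ sublead≈k ⟩
      k · 1#                    ∎)
  sublead-bounded-step p {r} eq (inj₁ r≈-1) (k , k≤m , sublead≈k) =
    suc k , s≤s k≤m , (begin
      sublead p                   ≈⟨ +-identityʳ _ ⟨
      sublead p + 0#              ≈⟨ +-congˡ (-‿inverseˡ 1#) ⟨
      sublead p + (- 1# + 1#)     ≈⟨ +-assoc _ _ _ ⟨
      (sublead p + - 1#) + 1#     ≈⟨ +-congʳ (+-congˡ r≈-1) ⟨
      (sublead p + r) + 1#        ≈⟨ +-congʳ eq ⟨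
      sublead (quotient p r) + 1# ≈⟨ +-congʳ sublead≈k ⟩
      k · 1# + 1#                 ≈⟨ +-comm _ _ ⟩
      1# + k · 1#                 ∎)

  sublead-bounded : ∀ m (p : Vector Carrier (suc m)) → lead p ≈ 1# →
    (∀ {x} → eval p x ≈ 0# → x ≈ - 1# ⊎ x ≈ 0#) → SubleadBounded p
  sublead-bounded zero    p _      _     = 0 , z≤n , ≈-refl
  sublead-bounded (suc m) p lead≈1 roots =
    -- Monicity makes the leading coefficient apart from 0, so a root exists to split off.
    let r , root = algebraicallyClosed m p (#-congʳ (≈-sym lead≈1) 1#0) in
    sublead-bounded-step p (sublead-quotient p lead≈1 root) (roots root)
      (sublead-bounded m (quotient p r) (≈-trans (lead-quotient p r) lead≈1)
        (λ {x} qx≈0 → roots (quotient-root p root qx≈0)))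

  1≉-1,0 : ¬ (1# ≈ - 1# ⊎ 1# ≈ 0#)
  1≉-1,0 (inj₁ 1≈-1) = characteristicZero 1 (begin
    1# + (1# + 0#)  ≈⟨ +-cong 1≈-1 (+-identityʳ 1#) ⟩
    - 1# + 1#       ≈⟨ -‿inverseˡ 1# ⟩
    0#              ∎)
  1≉-1,0 (inj₂ 1≈0) = characteristicZero 0 (≈-trans (+-identityʳ 1#) 1≈0)

  coefficient : ∀ {m} (G : SimpleGraph m) {k l} i → toℕ i ≡ k → dₜ G k ≡ l →
    fromℕ-coeffs (Dₜ G) i ≈ l · 1#
  coefficient G i refl refl = ≈-refl

  module _ {m} (G : SimpleGraph (suc (suc m))) (td : TotalDominating G ⊤)
    (roots : ∀ {x} → Z (Dₜ G) x → x ≈ - 1# ⊎ x ≈ 0#) where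

    coeffs : Vector Carrier (suc (suc (suc m)))
    coeffs = fromℕ-coeffs (Dₜ G)

    coeffs₀≈0 : coeffs zero ≈ 0#
    coeffs₀≈0 = coefficient G zero refl (dₜ-small G zero z≤n)

    coeffs₁≈0 : coeffs (suc zero) ≈ 0#
    coeffs₁≈0 = coefficient G (suc zero) refl (dₜ-small G zero ℕ.≤-refl)

    lead-coeffs : lead coeffs ≈ 1#
    lead-coeffs = ≈-trans
      (coefficient G (fromℕ (suc (suc m))) (toℕ-fromℕ _) (dₜ-top G td)) (+-identityʳ 1#)

    Dₜ/x²-bounded : SubleadBounded (tail (tail coeffs))
    Dₜ/x²-bounded = sublead-bounded m (tail (tail coeffs)) lead-coeffs
      -- Both removed coefficients vanish, so a root of `Dₜ / x²` is a root of `Dₜ`.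
      (λ root → roots (eval-tail-root coeffs coeffs₀≈0
                        (eval-tail-root (tail coeffs) coeffs₁≈0 root)))

  sublead⇒dₜ-bounded : ∀ {m} (G : SimpleGraph (suc (suc m))) →
    SubleadBounded (tail (tail (fromℕ-coeffs (Dₜ G)))) → dₜ G (suc m) ≤ m
  -- On two vertices `Dₜ / x²` is constant and its `sublead` is only the default; the bound comes
  -- from the absence of total dominating sets of size one.
  sublead⇒dₜ-bounded {zero}  G _ = ℕ.≤-reflexive (dₜ-small G zero ℕ.≤-refl)
  sublead⇒dₜ-bounded {suc m} G (k , k≤ , sublead≈k) =
    subst (_≤ suc m) (sym dₜ≡k) k≤
    where
    dₜ≈ : fromℕ-coeffs (Dₜ G) (suc (suc (inject₁ (fromℕ m)))) ≈ dₜ G (suc (suc m)) · 1#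
    dₜ≈ = coefficient G (suc (suc (inject₁ (fromℕ m))))
            (cong (λ j → suc (suc j)) (trans (toℕ-inject₁ (fromℕ m)) (toℕ-fromℕ m))) refl

    dₜ≡k : dₜ G (suc (suc m)) ≡ k
    -- Characteristic zero turns the equality in the field into one of natural numbers.
    dₜ≡k = ·-injective _ k (≈-trans (≈-sym dₜ≈) sublead≈k)

  RootSet[-1,0] : SimpleGraph n → Set (c ⊔ ℓ₁)
  RootSet[-1,0] G = Z (Dₜ G) ≐ ((λ z → z ≈ - 1#) ∪ (λ z → z ≈ 0#))

  -- With an isolated vertex `Dₜ` would vanish at 1, which is neither -1 nor 0.
  noIsolatedVertices : (G : SimpleGraph n) → RootSet[-1,0] G → TotalDominating G ⊤
  noIsolatedVertices G (roots , _) = decidable-stable (totalDominating? G ⊤) λ ¬td →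
    1≉-1,0 (roots (eval-zero (fromℕ-coeffs (Dₜ G))
      (λ i → coefficient G i refl (dₜ-isolated G ¬td (toℕ i))) 1#))

  atLeastTwoSupportVertices : (G : SimpleGraph n) → RootSet[-1,0] G → TotalDominating G ⊤ →
    AtLeastTwoSupportVertices G
  -- For the empty graph `Dₜ` is the constant 1, so 0 cannot be a root.
  atLeastTwoSupportVertices {zero} G (_ , roots⁻¹) td = contradiction
    (≈-trans (≈-sym (eval-constant (fromℕ-coeffs (Dₜ G)) 0#)) (roots⁻¹ (inj₂ ≈-refl)))
    (characteristicZero 0)
  atLeastTwoSupportVertices {suc zero} G _ td with td zero
  ... | zero , _ , 0~0 = contradiction 0~0 (SimpleGraph.irrefl G refl)
  atLeastTwoSupportVertices {suc (suc m)} G (roots , _) td =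
    fromInj₁
      -- The other alternative gives `suc m ≤ dₜ G (suc m)`, against the bound `m` from the roots.
      (λ 2+m≤ → contradiction (ℕ.≤-pred 2+m≤)
        (ℕ.<⇒≱ (s≤s (sublead⇒dₜ-bounded G (Dₜ/x²-bounded G td roots)))))
      (twoSupportVertices⊎n≤1+dₜ G td)

theorem4p2 : ∀ {c ℓ₁ ℓ₂} (K : AlgebraicallyClosedField₀ c ℓ₁ ℓ₂) →
    let open AlgebraicallyClosedField₀ K in
    (n : ℕ) (G : SimpleGraph n) →
    Z (Dₜ G) ≐ ((λ z → z ≈ - 1#) ∪ (λ z → z ≈ 0#)) →
    AtLeastTwoSupportVertices G
theorem4p2 K n G rootSet =
  atLeastTwoSupportVertices G rootSet (noIsolatedVertices G rootSet)
  where open ClosedField K
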